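{- Let $G$ be a finite abelian group, $H_1$ a subgroup of $G$, and $A_1$ a proper subset of $H_1$ such that the elements $x-y$ ($x,y\in A_1$) generate $H_1$. Let $S$ be the set of all subgroups $J\le G$ such that $A_1$ is a union of cosets of $J$. Choose any set (possibly empty) of cosets of $H_1$ different from $H_1$ itself, and partition each chosen coset into cosets of subgroups belonging to $S$. Let $\mathcal{A}$ consist of $A_1$ together with all sets in these partitions. Then $\mathcal{A}$ is a bimodal collection of pairwise disjoint subsets of $G$ in which $A_1$ is the unique member whose size is smaller than the order of its internal difference group.
   Context: $G$ is written additively. The internal difference group of a subset $T\subseteq G$ is the subgroup generated by all $x-y$ with $x,y\in T$. A collection $\{A_1,\dots,A_m\}$ of pairwise disjoint subsets of $G$ is bimodal if for every $i$ and every $\delta\in G\setminus\{0\}$, the number $N_i(\delta)$ of pairs $(a,b)$ with $a\in A_i$, $b\in A_j$ for some $j\neq i$, and $a-b=\delta$, satisfies $N_i(\delta)\in\{0,|A_i|\}$. -}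

module Defs where

open import Algebra.Bundles using (AbelianGroup)
import Data.Bool.Properties as Bool
open import Data.Fin using (Fin)
import Data.Fin.Properties as Fin
open import Data.Fin.Subset using (Subset; inside; outside; ⋃; ⋂; ∣_∣; Nonempty; Empty; _∩_)
  renaming (_∈_ to _∈ˢ_)
open import Data.Fin.Subset.Properties using (_∈?_)
open import Data.List
  using (List; []; _∷_; length; map; filter; allFin; cartesianProduct; cartesianProductWith)
open import Data.List.Membership.Propositional using (_∈_)
open import Data.List.Relation.Unary.All using (All; all?)
open import Data.Nat using (ℕ; zero; suc)
open import Data.Product using (∃; _×_; _,_; uncurry)
open import Data.Sum using (_⊎_)
import Data.Vec as Vec
import Data.Vec.Properties as Vec
open import Function.Bundles using (Inverse; _⇔_)
open import Level using (_⊔_) renaming (suc to lsuc)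
open import Relation.Binary.Definitions using (Decidable; DecidableEquality)
open import Relation.Binary.PropositionalEquality as ≡ using (_≡_; _≢_)
open import Relation.Nullary.Decidable using (Dec; map′; _×-dec_; _→-dec_; ¬?)
open import Relation.Nullary.Negation using (¬_)

record FiniteAbelianGroup c ℓ : Set (lsuc (c ⊔ ℓ)) where
  field
    abelianGroup : AbelianGroup c ℓ
    order        : ℕ
    enumeration  : Inverse (AbelianGroup.setoid abelianGroup) (≡.setoid (Fin order))

allSubsets : ∀ n → List (Subset n)
allSubsets zero    = Vec.[] ∷ []
allSubsets (suc n) = cartesianProductWith Vec._∷_ (outside ∷ inside ∷ []) (allSubsets n)

-- Subsets of a finite abelian group are subsets of the index set of its
-- enumeration.  A finite set of subsets is given by a list; only membership in
-- the list matters, so order and repetitions are irrelevant, and distinctness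
-- of members is distinctness as sets.

module Subsets {c ℓ} (G : FiniteAbelianGroup c ℓ) where

  open FiniteAbelianGroup G public
  open AbelianGroup abelianGroup public
    using (Carrier; _≈_; _-_)
    renaming (_∙_ to _+_; ε to 0#; _⁻¹ to -_)
  open AbelianGroup abelianGroup using (sym; trans; ∙-cong; ⁻¹-cong)
  open Inverse enumeration using (to; from; to-cong; strictlyInverseʳ)

  infix 4 _∈ᴳ_ _∈ᴳ?_ _≈?_ _≟_

  _∈ᴳ_ : Carrier → Subset order → Set
  x ∈ᴳ A = to x ∈ˢ A

  _∈ᴳ?_ : Decidable _∈ᴳ_
  x ∈ᴳ? A = to x ∈? A

  ∈ᴳ-resp-≈ : ∀ {x y A} → x ≈ y → x ∈ᴳ A → y ∈ᴳ A
  ∈ᴳ-resp-≈ {A = A} x≈y = ≡.subst (_∈ˢ A) (to-cong x≈y)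

  _≈?_ : Decidable _≈_
  x ≈? y = map′
    (λ eq → trans (sym (strictlyInverseʳ x))
                  (trans (AbelianGroup.reflexive abelianGroup (≡.cong from eq))
                         (strictlyInverseʳ y)))
    to-cong (to x Fin.≟ to y)

  _≟_ : DecidableEquality (Subset order)
  _≟_ = Vec.≡-dec Bool._≟_

  all-elements? : ∀ {p} {P : Carrier → Set p} →
                  (∀ {x y} → x ≈ y → P x → P y) →
                  (∀ x → Dec (P x)) → Dec (∀ x → P x)
  all-elements? resp P? = map′
    (λ h x → resp (strictlyInverseʳ x) (h (to x)))
    (λ h i → h (from i))
    (Fin.all? (λ i → P? (from i)))

  elements : Subset order → List Carrier
  elements A = map from (filter (_∈? A) (allFin order))

  record IsSubgroup (J : Subset order) : Set c where
    field
      0#-mem     : 0# ∈ᴳ J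
      +-closed   : ∀ x y → x ∈ᴳ J → y ∈ᴳ J → (x + y) ∈ᴳ J
      neg-closed : ∀ x → x ∈ᴳ J → (- x) ∈ᴳ J

  isSubgroup? : ∀ J → Dec (IsSubgroup J)
  isSubgroup? J = map′
    (λ (z , p , m) → record { 0#-mem = z ; +-closed = p ; neg-closed = m })
    (λ s → let open IsSubgroup s in 0#-mem , +-closed , neg-closed)
    ((0# ∈ᴳ? J)
      ×-dec all-elements?
        (λ x≈x′ h y x∈ y∈ → ∈ᴳ-resp-≈ {A = J} (∙-cong x≈x′ refl)
                              (h y (∈ᴳ-resp-≈ {A = J} (sym x≈x′) x∈) y∈))
        (λ x → all-elements?
          (λ y≈y′ h x∈ y∈ → ∈ᴳ-resp-≈ {A = J} (∙-cong refl y≈y′)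
                              (h x∈ (∈ᴳ-resp-≈ {A = J} (sym y≈y′) y∈)))
          (λ y → (x ∈ᴳ? J) →-dec ((y ∈ᴳ? J) →-dec ((x + y) ∈ᴳ? J))))
      ×-dec all-elements?
        (λ x≈x′ h x∈ → ∈ᴳ-resp-≈ {A = J} (⁻¹-cong x≈x′)
                         (h (∈ᴳ-resp-≈ {A = J} (sym x≈x′) x∈)))
        (λ x → (x ∈ᴳ? J) →-dec ((- x) ∈ᴳ? J)))
    where open AbelianGroup abelianGroup using (refl)

  ⟨_⟩ : List Carrier → Subset order
  ⟨ xs ⟩ = ⋂ (filter (λ J → isSubgroup? J ×-dec all? (_∈ᴳ? J) xs) (allSubsets order))

  internalDifferenceGroup : Subset order → Subset order
  internalDifferenceGroup T = ⟨ cartesianProductWith _-_ (elements T) (elements T) ⟩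

  IsCoset : Subset order → Subset order → Set (c ⊔ ℓ)
  IsCoset J K = ∃ λ g → ∀ x → x ∈ᴳ K ⇔ (∃ λ j → j ∈ᴳ J × x ≈ g + j)

  IsUnionOfCosets : Subset order → Subset order → Set (c ⊔ ℓ)
  IsUnionOfCosets J A = ∃ λ 𝒦 → (∀ {K} → K ∈ 𝒦 → IsCoset J K) × A ≡ ⋃ 𝒦

  PairwiseDisjoint : List (Subset order) → Set
  PairwiseDisjoint 𝒜 = ∀ {A B} → A ∈ 𝒜 → B ∈ 𝒜 → A ≢ B → Empty (A ∩ B)

  record IsPartition (𝒫 : List (Subset order)) (C : Subset order) : Set where
    field
      nonempty : ∀ {B} → B ∈ 𝒫 → Nonempty B
      disjoint : PairwiseDisjoint 𝒫
      covers   : ⋃ 𝒫 ≡ C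

  others : List (Subset order) → Subset order → List (Subset order)
  others 𝒜 A = filter (λ B → ¬? (B ≟ A)) 𝒜

  -- The number of pairs (a , b) with a ∈ A, b in some other member of 𝒜, and
  -- a - b ≈ δ.
  N : List (Subset order) → Subset order → Carrier → ℕ
  N 𝒜 A δ = length (filter (λ (a , b) → (a - b) ≈? δ)
                           (cartesianProduct (elements A) (elements (⋃ (others 𝒜 A)))))

  IsBimodal : List (Subset order) → Set (c ⊔ ℓ)
  IsBimodal 𝒜 = ∀ {A} → A ∈ 𝒜 → ∀ δ → ¬ (δ ≈ 0#) → N 𝒜 A δ ≡ 0 ⊎ N 𝒜 A δ ≡ ∣ A ∣

{-# OPTIONS --safe #-}
-- Let U be the union of the chosen cosets of H₁.  The partners of A₁ form U, a
-- union of cosets of H₁, and A₁ lies in a single coset of H₁.  The partners of a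
-- coset B of J form (A₁ ∪ U) ∖ B, a union of cosets of J, because J ≤ H₁.  So in
-- each case whether a - δ is a partner of a member's element a does not depend on
-- a, and each a has at most one partner at difference δ.  Finally a coset of J has
-- exactly as many elements as J, which contains its internal difference group.
module Submission where

open import Defs
open import Algebra.Bundles using (AbelianGroup)
import Algebra.Properties.AbelianGroup as AbelianGroupProperties
open import Data.Empty using (⊥-elim)
open import Data.Fin using (Fin; zero; suc)
open import Data.Fin.Properties using (suc-injective; 0≢1+n)
open import Data.Fin.Subset
  using (Subset; inside; outside; ∣_∣; _⊂_; _⊆_; ⋃; ⋂)
  renaming (_∈_ to _∈ˢ_; _-_ to _∖_)
open import Data.Fin.Subset.Properties
  using (_∈?_; ∉⊥; x∈p∪q⁻; x∈p∪q⁺; x∈p∩q⁻; x∈p∩q⁺; ⊆-antisym; p⊆q⇒∣p∣≤∣q∣;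
         p⊂q⇒∣p∣<∣q∣; x∈p⇒∣p-x∣<∣p∣; x∈p∧x≢y⇒x∈p-y; drop-there)
open import Data.List
  using (List; []; _∷_; concatMap; length; map; filter; tabulate; allFin;
         cartesianProduct)
open import Data.List.Membership.Propositional using (_∈_; find; lose)
open import Data.List.Membership.Propositional.Properties
  using (∈-filter⁺; ∈-filter⁻; ∈-map⁺; ∈-map⁻; ∈-allFin; ∈-concatMap⁺; ∈-concatMap⁻;
         ∈-cartesianProductWith⁺; ∈-cartesianProductWith⁻; ∈-cartesianProduct⁻)
open import Data.List.Properties
  using (length-map; length-++; filter-++; filter-accept; filter-reject; filter-none)
import Data.List.Relation.Unary.All as All
open import Data.List.Relation.Unary.AllPairs using (_∷_)
open import Data.List.Relation.Unary.Any using (here; there; any?)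
open import Data.List.Relation.Unary.Unique.Propositional using (Unique)
import Data.List.Relation.Unary.Unique.Propositional.Properties as Unique
open import Data.Nat using (ℕ; _≤_; _<_; _+_; z≤n; s≤s)
open import Data.Nat.Properties using (≤-trans; ≤⇒≯)
open import Data.Product using (∃; _×_; _,_; proj₁; proj₂)
open import Data.Sum using (_⊎_; inj₁; inj₂)
import Data.Vec as Vec
open import Data.Vec.Base using (here; there)
open import Function using (_∘_)
open import Function.Bundles using (Inverse; Equivalence; _⇔_; mk⇔)
open import Relation.Binary.PropositionalEquality
  using (_≡_; _≢_; refl; sym; trans; cong; cong₂; subst)
import Relation.Binary.Reasoning.Setoid as ≈-Reasoning
open import Relation.Nullary using (¬_; yes; no)
open import Relation.Nullary.Decidable using (_×-dec_; ¬?)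
open import Relation.Unary using (Pred; Decidable)

open Equivalence using () renaming (to to ⇒; from to ⇐)

-- Unions, intersections and sizes of finite subsets.

∈-⋃⁻ : ∀ {n} (ps : List (Subset n)) {i} → i ∈ˢ ⋃ ps → ∃ λ p → p ∈ ps × i ∈ˢ p
∈-⋃⁻ []       i∈ = ⊥-elim (∉⊥ i∈)
∈-⋃⁻ (p ∷ ps) i∈ with x∈p∪q⁻ p (⋃ ps) i∈
... | inj₁ i∈p = p , here refl , i∈p
... | inj₂ i∈⋃ = let q , q∈ps , i∈q = ∈-⋃⁻ ps i∈⋃ in q , there q∈ps , i∈q

∈-⋃⁺ : ∀ {n} {ps : List (Subset n)} {p i} → p ∈ ps → i ∈ˢ p → i ∈ˢ ⋃ ps
∈-⋃⁺ (here refl)  i∈p = x∈p∪q⁺ (inj₁ i∈p)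
∈-⋃⁺ (there p∈ps) i∈p = x∈p∪q⁺ (inj₂ (∈-⋃⁺ p∈ps i∈p))

∈-⋂⁻ : ∀ {n} {ps : List (Subset n)} {p i} → p ∈ ps → i ∈ˢ ⋂ ps → i ∈ˢ p
∈-⋂⁻ {ps = p ∷ ps} (here refl)  i∈ = proj₁ (x∈p∩q⁻ p (⋂ ps) i∈)
∈-⋂⁻ {ps = p ∷ ps} (there q∈ps) i∈ = ∈-⋂⁻ q∈ps (proj₂ (x∈p∩q⁻ p (⋂ ps) i∈))

∈-allSubsets : ∀ {n} (p : Subset n) → p ∈ allSubsets n
∈-allSubsets Vec.[]      = here refl
∈-allSubsets (s Vec.∷ p) = ∈-cartesianProductWith⁺ Vec._∷_ (∈-sides s) (∈-allSubsets p)
  where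
  ∈-sides : ∀ s → s ∈ outside ∷ inside ∷ []
  ∈-sides outside = here refl
  ∈-sides inside  = there (here refl)

-- Induction on `p`: when `zero` lies in `p`, the value `f zero` is removed from `q`, and
-- injectivity keeps the remaining values away from it. Two index sets let the domain shrink while
-- the codomain stays.
injective⇒∣p∣≤∣q∣ : ∀ {m n} (p : Subset m) (q : Subset n) (f : Fin m → Fin n) →
                    (∀ {i j} → f i ≡ f j → i ≡ j) → (∀ {i} → i ∈ˢ p → f i ∈ˢ q) →
                    ∣ p ∣ ≤ ∣ q ∣
injective⇒∣p∣≤∣q∣ Vec.[]            q f inj f∈ = z≤n
injective⇒∣p∣≤∣q∣ (outside Vec.∷ p) q f inj f∈ =
  injective⇒∣p∣≤∣q∣ p q (f ∘ suc) (suc-injective ∘ inj) (f∈ ∘ there)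
injective⇒∣p∣≤∣q∣ (inside Vec.∷ p)  q f inj f∈ = ≤-trans
  (s≤s (injective⇒∣p∣≤∣q∣ p (q ∖ f zero) (f ∘ suc) (suc-injective ∘ inj)
    (λ i∈p → x∈p∧x≢y⇒x∈p-y (f∈ (there i∈p)) (0≢1+n ∘ sym ∘ inj))))
  (x∈p⇒∣p-x∣<∣p∣ (f∈ here))

-- Lengths of filtered lists.

module _ {a p} {A : Set a} {P : Pred A p} (P? : Decidable P) where

  -- `f` is general because the tail of `tabulate f` is `tabulate (f ∘ suc)`; the identity gives
  -- `allFin`.
  length-filter-tabulate : ∀ {n} (f : Fin n → A) (q : Subset n) →
                           (∀ i → P (f i) ⇔ i ∈ˢ q) →
                           length (filter P? (tabulate f)) ≡ ∣ q ∣
  length-filter-tabulate f Vec.[] P⇔ = refl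
  length-filter-tabulate f (s Vec.∷ q) P⇔
    with ih ← length-filter-tabulate (f ∘ suc) q
                (λ i → mk⇔ (drop-there ∘ ⇒ (P⇔ (suc i))) (⇐ (P⇔ (suc i)) ∘ there))
    with s
  ... | inside  = trans (cong length (filter-accept P? (⇐ (P⇔ zero) here))) (cong ℕ.suc ih)
  ... | outside = trans (cong length (filter-reject P? ((λ ()) ∘ ⇒ (P⇔ zero)))) ih

  length-filter-unique : ∀ {x xs} → Unique xs → x ∈ xs → P x →
                         (∀ {y} → y ∈ xs → P y → y ≡ x) → length (filter P? xs) ≡ 1
  length-filter-unique {x} {y ∷ xs} (y∉ ∷ _) (here refl) Px only =
    trans (cong length (filter-accept P? Px))
          (cong (ℕ.suc ∘ length) (filter-none P? (All.tabulate λ z∈ Pz →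
            All.lookup y∉ z∈ (sym (only (there z∈) Pz)))))
  length-filter-unique {x} {y ∷ xs} (y∉ ∷ u) (there x∈) Px only =
    trans (cong length (filter-reject P? λ Py → All.lookup y∉ x∈ (only (here refl) Py)))
          (length-filter-unique u x∈ Px (only ∘ there))

-- The product is a concatenation of rows, one for each entry of `as`, and each row contributes
-- exactly one pair.
length-filter-cartesianProduct :
  ∀ {a b p} {A : Set a} {B : Set b} {P : Pred (A × B) p} (P? : Decidable P) as {bs} →
  (∀ {x} → x ∈ as → length (filter P? (map (x ,_) bs)) ≡ 1) →
  length (filter P? (cartesianProduct as bs)) ≡ length as
length-filter-cartesianProduct P? []       one = refl
length-filter-cartesianProduct P? (x ∷ as) {bs} one = trans
  (trans (cong length (filter-++ P? (map (x ,_) bs) (cartesianProduct as bs)))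
         (length-++ (filter P? (map (x ,_) bs))))
  (cong₂ _+_ (one (here refl)) (length-filter-cartesianProduct P? as (one ∘ there)))

-- Finite abelian groups: enumeration, differences and generated subgroups.

module FiniteAbelianGroupProperties {c ℓ} (G : FiniteAbelianGroup c ℓ) where

  open Subsets G renaming (_+_ to _⊕_)
  open AbelianGroup abelianGroup
    using (setoid; assoc; comm; identityˡ; ∙-cong; ∙-congˡ; ∙-congʳ; ⁻¹-cong)
    renaming (refl to ≈-refl; sym to ≈-sym; trans to ≈-trans; reflexive to ≈-reflexive)
  open AbelianGroupProperties abelianGroup
    using (xyx⁻¹≈y; \\-leftDividesˡ; \\-leftDividesʳ; //-rightDividesʳ; ⁻¹-anti-homo-//;
           ⁻¹-∙-comm; ∙-cancelˡ)
  open Inverse enumeration using (to; from; to-cong; strictlyInverseˡ; strictlyInverseʳ)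

  from-injective : ∀ {i j} → from i ≡ from j → i ≡ j
  from-injective {i} {j} eq =
    trans (sym (strictlyInverseˡ i)) (trans (cong to eq) (strictlyInverseˡ j))

  to-injective : ∀ {x y} → to x ≡ to y → x ≈ y
  to-injective {x} {y} eq = ≈-trans (≈-sym (strictlyInverseʳ x))
    (≈-trans (≈-reflexive (cong from eq)) (strictlyInverseʳ y))

  ∈ˢ⇒∈ᴳ : ∀ {i} A → i ∈ˢ A → from i ∈ᴳ A
  ∈ˢ⇒∈ᴳ A = subst (_∈ˢ A) (sym (strictlyInverseˡ _))

  ∈ᴳ⇒⊆ : ∀ {A B} → (∀ {x} → x ∈ᴳ A → x ∈ᴳ B) → A ⊆ B
  ∈ᴳ⇒⊆ {A} {B} A⊆B i∈A = subst (_∈ˢ B) (strictlyInverseˡ _) (A⊆B (∈ˢ⇒∈ᴳ A i∈A))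

  x+[y-x]≈y : ∀ x y → x ⊕ (y - x) ≈ y
  x+[y-x]≈y x y = ≈-trans (≈-sym (assoc x y (- x))) (xyx⁻¹≈y x y)

  x-[x-y]≈y : ∀ x y → x - (x - y) ≈ y
  x-[x-y]≈y x y = ≈-trans (∙-congˡ (⁻¹-anti-homo-// x y)) (x+[y-x]≈y x y)

  [x-z]+[y-x]≈y-z : ∀ x y z → (x - z) ⊕ (y - x) ≈ y - z
  [x-z]+[y-x]≈y-z x y z = begin
    (x - z) ⊕ (y - x)       ≈⟨ comm (x - z) (y - x) ⟩
    (y - x) ⊕ (x - z)       ≈⟨ assoc y (- x) (x - z) ⟩
    y ⊕ (- x ⊕ (x ⊕ - z))   ≈⟨ ∙-congˡ (\\-leftDividesʳ x (- z)) ⟩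
    y - z                   ∎
    where open ≈-Reasoning setoid

  [g+x]-[g+y]≈x-y : ∀ g x y → (g ⊕ x) - (g ⊕ y) ≈ x - y
  [g+x]-[g+y]≈x-y g x y = begin
    (g ⊕ x) ⊕ - (g ⊕ y)       ≈⟨ ∙-cong (comm g x) (≈-sym (⁻¹-∙-comm g y)) ⟩
    (x ⊕ g) ⊕ (- g ⊕ - y)     ≈⟨ assoc x g (- g ⊕ - y) ⟩
    x ⊕ (g ⊕ (- g ⊕ - y))     ≈⟨ ∙-congˡ (\\-leftDividesˡ g (- y)) ⟩
    x - y                     ∎
    where open ≈-Reasoning setoid

  -- The second component says that only the representative chosen by the enumeration is listed. It
  -- turns `_≈_` into `_≡_` when a partner is shown to be unique.
  ∈-elements⁻ : ∀ A {x} → x ∈ elements A → x ∈ᴳ A × x ≡ from (to x)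
  ∈-elements⁻ A x∈ with ∈-map⁻ from x∈
  ... | i , i∈ , refl = ∈ˢ⇒∈ᴳ A (proj₂ (∈-filter⁻ (_∈? A) {xs = allFin order} i∈))
                      , cong from (sym (strictlyInverseˡ i))

  ∈-elements⁺ : ∀ A {x} → x ∈ᴳ A → from (to x) ∈ elements A
  ∈-elements⁺ A x∈A = ∈-map⁺ from (∈-filter⁺ (_∈? A) (∈-allFin _) x∈A)

  elements-unique : ∀ A → Unique (elements A)
  elements-unique A = Unique.map⁺ from-injective (Unique.filter⁺ (_∈? A) (Unique.allFin⁺ order))

  length-elements : ∀ A → length (elements A) ≡ ∣ A ∣
  length-elements A = trans (length-map from (filter (_∈? A) (allFin order)))
    (length-filter-tabulate (_∈? A) (λ i → i) A (λ i → mk⇔ (λ z → z) (λ z → z)))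

  -- The generated subgroup is an intersection over all subgroups that contain the listed
  -- differences, and `J` is one of them.
  internalDifferenceGroup-least :
    ∀ {T J} → IsSubgroup J → (∀ {x y} → x ∈ᴳ T → y ∈ᴳ T → (x - y) ∈ᴳ J) →
    internalDifferenceGroup T ⊆ J
  internalDifferenceGroup-least {T} {J} J≤G diff =
    ∈-⋂⁻ (∈-filter⁺ (λ J → isSubgroup? J ×-dec All.all? (_∈ᴳ? J) _) (∈-allSubsets J)
      (J≤G , All.tabulate λ z∈ →
        let x , y , x∈ , y∈ , z≡ = ∈-cartesianProductWith⁻ _-_ (elements T) (elements T) z∈
        in subst (_∈ᴳ J) (sym z≡) (diff (proj₁ (∈-elements⁻ T x∈)) (proj₁ (∈-elements⁻ T y∈)))))

  -- Cosets, invariant sets and counts of differences.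

  subgroup-isCoset : ∀ {J} → IsCoset J J
  subgroup-isCoset {J} = 0# , λ x → mk⇔
    (λ x∈J → x , x∈J , ≈-sym (identityˡ x))
    (λ (j , j∈J , x≈) → ∈ᴳ-resp-≈ {A = J} (≈-sym (≈-trans x≈ (identityˡ j))) j∈J)

  -- For a subgroup `J` this amounts to being a union of cosets of `J`, with no list of cosets to
  -- carry along.
  ClosedUnder : Subset order → Subset order → Set c
  ClosedUnder J A = ∀ {x j} → x ∈ᴳ A → j ∈ᴳ J → (x ⊕ j) ∈ᴳ A

  module _ {J} (J≤G : IsSubgroup J) where

    open IsSubgroup J≤G

    coset-diff : ∀ {K x y} → IsCoset J K → x ∈ᴳ K → y ∈ᴳ K → (x - y) ∈ᴳ J
    coset-diff {x = x} {y} (g , K⇔) x∈K y∈K =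
      let i , i∈J , x≈ = ⇒ (K⇔ x) x∈K
          j , j∈J , y≈ = ⇒ (K⇔ y) y∈K
      in ∈ᴳ-resp-≈ {A = J}
           (≈-sym (≈-trans (∙-cong x≈ (⁻¹-cong y≈)) ([g+x]-[g+y]≈x-y g i j)))
           (+-closed i (- j) i∈J (neg-closed j j∈J))

    coset-closed : ∀ {K} → IsCoset J K → ClosedUnder J K
    coset-closed (g , K⇔) {x} {j} x∈K j∈J =
      let i , i∈J , x≈ = ⇒ (K⇔ x) x∈K
      in ⇐ (K⇔ (x ⊕ j)) (i ⊕ j , +-closed i j i∈J j∈J , ≈-trans (∙-congʳ x≈) (assoc g i j))

    unionOfCosets-closed : ∀ {A} → IsUnionOfCosets J A → ClosedUnder J A
    unionOfCosets-closed (𝒦 , coset , refl) x∈A j∈J =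
      let K , K∈𝒦 , x∈K = ∈-⋃⁻ 𝒦 x∈A
      in ∈-⋃⁺ K∈𝒦 (coset-closed (coset K∈𝒦) x∈K j∈J)

    closed-cancel : ∀ {A x j} → ClosedUnder J A → (x ⊕ j) ∈ᴳ A → j ∈ᴳ J → x ∈ᴳ A
    closed-cancel {A} {x} {j} closed x+j∈A j∈J =
      ∈ᴳ-resp-≈ {A = A} (//-rightDividesʳ j x) (closed x+j∈A (neg-closed j j∈J))

    -- A point `y` of `K` is `x` plus `y - x`; this difference lies in `J`, and `L` absorbs it.
    coset-⊆ : ∀ {K L x} → IsCoset J K → IsCoset J L → x ∈ᴳ K → x ∈ᴳ L → K ⊆ L
    coset-⊆ {K} {L} {x} K-coset L-coset x∈K x∈L = ∈ᴳ⇒⊆ λ {y} y∈K →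
      ∈ᴳ-resp-≈ {A = L} (x+[y-x]≈y x y)
        (coset-closed L-coset x∈L (coset-diff K-coset y∈K x∈K))

    coset-≡ : ∀ {K L x} → IsCoset J K → IsCoset J L → x ∈ᴳ K → x ∈ᴳ L → K ≡ L
    coset-≡ K-coset L-coset x∈K x∈L =
      ⊆-antisym (coset-⊆ K-coset L-coset x∈K x∈L) (coset-⊆ L-coset K-coset x∈L x∈K)

    -- Translation by the representative `g` injects `J` into `K`.
    ∣subgroup∣≤∣coset∣ : ∀ {K} → IsCoset J K → ∣ J ∣ ≤ ∣ K ∣
    ∣subgroup∣≤∣coset∣ {K} (g , K⇔) = injective⇒∣p∣≤∣q∣ J K (λ i → to (g ⊕ from i))
      (λ {i} {j} eq → trans (sym (strictlyInverseˡ i))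
        (trans (to-cong (∙-cancelˡ g _ _ (to-injective eq))) (strictlyInverseˡ j)))
      (λ {i} i∈J → ⇐ (K⇔ (g ⊕ from i)) (from i , ∈ˢ⇒∈ᴳ J i∈J , ≈-refl))

    ∣internalDifferenceGroup∣≤∣coset∣ :
      ∀ {K} → IsCoset J K → ∣ internalDifferenceGroup K ∣ ≤ ∣ K ∣
    ∣internalDifferenceGroup∣≤∣coset∣ K-coset = ≤-trans
      (p⊆q⇒∣p∣≤∣q∣ (internalDifferenceGroup-least J≤G (coset-diff K-coset)))
      (∣subgroup∣≤∣coset∣ K-coset)

  -- For `a` and `x` in `A`, the points `a - δ` and `x - δ` differ by an element of `J`, so the
  -- invariant set of partners contains both or neither.
  N-dichotomy : ∀ 𝒜 {A J} δ → (∀ {x y} → x ∈ᴳ A → y ∈ᴳ A → (x - y) ∈ᴳ J) →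
                ClosedUnder J (⋃ (others 𝒜 A)) → N 𝒜 A δ ≡ 0 ⊎ N 𝒜 A δ ≡ ∣ A ∣
  -- Whether some listed element of `A` has a partner decides which value the count takes.
  N-dichotomy 𝒜 {A} δ diff closed = case (any? (λ a → (a - δ) ∈ᴳ? W) (elements A))
    where
    W = ⋃ (others 𝒜 A)

    P? : Decidable (λ (p : Carrier × Carrier) → proj₁ p - proj₂ p ≈ δ)
    P? (a , b) = (a - b) ≈? δ

    b≈a-δ : ∀ {a b} → a - b ≈ δ → b ≈ a - δ
    b≈a-δ {a} {b} a-b≈δ =
      ≈-trans (≈-sym (x-[x-y]≈y a b)) (∙-congˡ (⁻¹-cong a-b≈δ))

    -- `a - b ≈ δ` forces `b ≈ a - δ`, and `elements W` lists this class once, as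
    -- `from (to (a - δ))`.
    one-partner : ∀ {a} → (a - δ) ∈ᴳ W → length (filter P? (map (a ,_) (elements W))) ≡ 1
    one-partner {a} a-δ∈W = length-filter-unique P?
      (Unique.map⁺ (cong proj₂) (elements-unique W))
      (∈-map⁺ (a ,_) (∈-elements⁺ W a-δ∈W))
      (≈-trans (∙-congˡ (⁻¹-cong (strictlyInverseʳ (a - δ)))) (x-[x-y]≈y a δ))
      only
      where
      only : ∀ {p} → p ∈ map (a ,_) (elements W) → proj₁ p - proj₂ p ≈ δ →
             p ≡ (a , from (to (a - δ)))
      only p∈ a-b≈δ with ∈-map⁻ (a ,_) p∈
      ... | b , b∈ , refl =
        cong (a ,_) (trans (proj₂ (∈-elements⁻ W b∈)) (cong from (to-cong (b≈a-δ a-b≈δ))))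

    case : _ → N 𝒜 A δ ≡ 0 ⊎ N 𝒜 A δ ≡ ∣ A ∣
    case (yes a-δ∈W) = inj₂ (trans
      (length-filter-cartesianProduct P? (elements A) λ {x} x∈ →
        -- The search found one `a` with `a - δ` in `W`; adding `x - a` from `J` carries this point
        -- to `x - δ`.
        let a , a∈ , a-δ∈ = find a-δ∈W
        in one-partner (∈ᴳ-resp-≈ {A = W} ([x-z]+[y-x]≈y-z a x δ)
             (closed a-δ∈ (diff (proj₁ (∈-elements⁻ A x∈)) (proj₁ (∈-elements⁻ A a∈))))))
      (length-elements A))
    case (no ¬a-δ∈W) = inj₁ (cong length (filter-none P? (All.tabulate λ {(a , b)} p∈ a-b≈δ →
      let a∈ , b∈ = ∈-cartesianProduct⁻ (elements A) (elements W) p∈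
      in ¬a-δ∈W (lose a∈ (∈ᴳ-resp-≈ {A = W} (b≈a-δ a-b≈δ) (proj₁ (∈-elements⁻ W b∈)))))))

  -- Pairwise disjoint collections and their partner sets.

  ∈-others⁻ : ∀ 𝒜 A {x} → x ∈ᴳ ⋃ (others 𝒜 A) → ∃ λ B → B ∈ 𝒜 × B ≢ A × x ∈ᴳ B
  ∈-others⁻ 𝒜 A x∈ =
    let B , B∈ , x∈B = ∈-⋃⁻ (others 𝒜 A) x∈
        B∈𝒜 , B≢A = ∈-filter⁻ (λ B → ¬? (B ≟ A)) {xs = 𝒜} B∈
    in B , B∈𝒜 , B≢A , x∈B

  ∈-others⁺ : ∀ {𝒜 A B x} → B ∈ 𝒜 → B ≢ A → x ∈ᴳ B → x ∈ᴳ ⋃ (others 𝒜 A)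
  ∈-others⁺ {A = A} B∈𝒜 B≢A = ∈-⋃⁺ (∈-filter⁺ (λ B → ¬? (B ≟ A)) B∈𝒜 B≢A)

  pairwiseDisjoint-≡ : ∀ {𝒜 A B x} → PairwiseDisjoint 𝒜 → A ∈ 𝒜 → B ∈ 𝒜 →
                       x ∈ᴳ A → x ∈ᴳ B → A ≡ B
  pairwiseDisjoint-≡ {A = A} {B} disjoint A∈𝒜 B∈𝒜 x∈A x∈B with A ≟ B
  ... | yes A≡B = A≡B
  ... | no  A≢B = ⊥-elim (disjoint A∈𝒜 B∈𝒜 A≢B (_ , x∈p∩q⁺ (x∈A , x∈B)))

  -- If `x ⊕ j` fell into `B`, cancelling `j` would put `x` in `B`, and by disjointness the member
  -- containing `x` would be `B` itself.
  others-closed : ∀ {𝒜 J B} → IsSubgroup J → PairwiseDisjoint 𝒜 → B ∈ 𝒜 →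
                  ClosedUnder J (⋃ 𝒜) → ClosedUnder J B → ClosedUnder J (⋃ (others 𝒜 B))
  others-closed {𝒜} {J} {B} J≤G disjoint B∈𝒜 ⋃-closed B-closed x∈ j∈J =
    let A , A∈𝒜 , A≢B , x∈A = ∈-others⁻ 𝒜 B x∈
        D , D∈𝒜 , x+j∈D = ∈-⋃⁻ 𝒜 (⋃-closed (∈-⋃⁺ A∈𝒜 x∈A) j∈J)
    in ∈-others⁺ D∈𝒜
         (λ D≡B → A≢B (pairwiseDisjoint-≡ disjoint A∈𝒜 B∈𝒜 x∈A
           (closed-cancel J≤G B-closed (subst (_ ∈ˢ_) D≡B x+j∈D) j∈J)))
         x+j∈D

  -- The collection formed by `A₁` and the partitioned cosets.

  module PartitionedCosets
    {H₁ A₁ : Subset order}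
    (H₁≤G : IsSubgroup H₁) (A₁⊆H₁ : A₁ ⊆ H₁)
    {𝒞 : List (Subset order)} (𝒞-cosets : ∀ {C} → C ∈ 𝒞 → IsCoset H₁ C × C ≢ H₁)
    {𝒫 : Subset order → List (Subset order)} (𝒫-partition : ∀ {C} → C ∈ 𝒞 → IsPartition (𝒫 C) C)
    (𝒫-cosets : ∀ {C B} → C ∈ 𝒞 → B ∈ 𝒫 C →
       ∃ λ J → IsSubgroup J × IsUnionOfCosets J A₁ × IsCoset J B)
    where

    𝒜 : List (Subset order)
    𝒜 = A₁ ∷ concatMap 𝒫 𝒞

    ∈-𝒜⁺ : ∀ {C B} → C ∈ 𝒞 → B ∈ 𝒫 C → B ∈ 𝒜
    ∈-𝒜⁺ C∈𝒞 B∈𝒫 = there (∈-concatMap⁺ 𝒫 (lose C∈𝒞 B∈𝒫))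

    ∈-𝒜⁻ : ∀ {B} → B ∈ 𝒜 → B ≡ A₁ ⊎ ∃ λ C → C ∈ 𝒞 × B ∈ 𝒫 C
    ∈-𝒜⁻ (here B≡A₁) = inj₁ B≡A₁
    ∈-𝒜⁻ (there B∈)  = inj₂ (find (∈-concatMap⁻ 𝒫 {xs = 𝒞} B∈))

    part⊆ : ∀ {C B} → C ∈ 𝒞 → B ∈ 𝒫 C → B ⊆ C
    part⊆ C∈𝒞 B∈𝒫 i∈B = subst (_ ∈ˢ_) (IsPartition.covers (𝒫-partition C∈𝒞)) (∈-⋃⁺ B∈𝒫 i∈B)

    part-of : ∀ {C i} → C ∈ 𝒞 → i ∈ˢ C → ∃ λ B → B ∈ 𝒫 C × i ∈ˢ B
    part-of {C} C∈𝒞 i∈C =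
      ∈-⋃⁻ (𝒫 C) (subst (_ ∈ˢ_) (sym (IsPartition.covers (𝒫-partition C∈𝒞))) i∈C)

    -- Cosets of `H₁` that meet coincide, and `H₁` is one of its own cosets. This separates `A₁`
    -- from every part.
    chosen-misses-H₁ : ∀ {C x} → C ∈ 𝒞 → x ∈ᴳ C → ¬ (x ∈ᴳ H₁)
    chosen-misses-H₁ C∈𝒞 x∈C x∈H₁ =
      let C-coset , C≢H₁ = 𝒞-cosets C∈𝒞
      in C≢H₁ (coset-≡ H₁≤G C-coset subgroup-isCoset x∈C x∈H₁)

    meeting-members-≡ : ∀ {A B x} → A ∈ 𝒜 → B ∈ 𝒜 → x ∈ᴳ A → x ∈ᴳ B → A ≡ B
    meeting-members-≡ A∈𝒜 B∈𝒜 x∈A x∈B with ∈-𝒜⁻ A∈𝒜 | ∈-𝒜⁻ B∈𝒜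
    ... | inj₁ refl | inj₁ refl = refl
    ... | inj₁ refl | inj₂ (D , D∈𝒞 , B∈𝒫) =
      ⊥-elim (chosen-misses-H₁ D∈𝒞 (part⊆ D∈𝒞 B∈𝒫 x∈B) (A₁⊆H₁ x∈A))
    ... | inj₂ (C , C∈𝒞 , A∈𝒫) | inj₁ refl =
      ⊥-elim (chosen-misses-H₁ C∈𝒞 (part⊆ C∈𝒞 A∈𝒫 x∈A) (A₁⊆H₁ x∈B))
    ... | inj₂ (C , C∈𝒞 , A∈𝒫) | inj₂ (D , D∈𝒞 , B∈𝒫)
      -- The chosen cosets around the two parts share `x`, hence coincide, so both parts belong to
      -- one partition.
      with refl ← coset-≡ H₁≤G (proj₁ (𝒞-cosets C∈𝒞)) (proj₁ (𝒞-cosets D∈𝒞))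
                    (part⊆ C∈𝒞 A∈𝒫 x∈A) (part⊆ D∈𝒞 B∈𝒫 x∈B)
      = pairwiseDisjoint-≡ (IsPartition.disjoint (𝒫-partition C∈𝒞)) A∈𝒫 B∈𝒫 x∈A x∈B

    𝒜-pairwiseDisjoint : PairwiseDisjoint 𝒜
    𝒜-pairwiseDisjoint {A} {B} A∈𝒜 B∈𝒜 A≢B (i , i∈) =
      let i∈A , i∈B = x∈p∩q⁻ A B i∈
      in A≢B (meeting-members-≡ A∈𝒜 B∈𝒜 (∈ˢ⇒∈ᴳ A i∈A) (∈ˢ⇒∈ᴳ B i∈B))

    -- Translation by `H₁` may carry `x` into another part, but within the same chosen coset; that
    -- coset avoids `H₁`, so the part reached is not `A₁`.
    A₁-others-closed : ClosedUnder H₁ (⋃ (others 𝒜 A₁))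
    A₁-others-closed x∈ j∈H₁ with ∈-others⁻ 𝒜 A₁ x∈
    ... | B , B∈𝒜 , B≢A₁ , x∈B with ∈-𝒜⁻ B∈𝒜
    ... | inj₁ B≡A₁ = ⊥-elim (B≢A₁ B≡A₁)
    ... | inj₂ (C , C∈𝒞 , B∈𝒫) =
      let x+j∈C = coset-closed H₁≤G (proj₁ (𝒞-cosets C∈𝒞)) (part⊆ C∈𝒞 B∈𝒫 x∈B) j∈H₁
          D , D∈𝒫 , x+j∈D = part-of C∈𝒞 x+j∈C
      in ∈-others⁺ (∈-𝒜⁺ C∈𝒞 D∈𝒫)
           (λ D≡A₁ → chosen-misses-H₁ C∈𝒞 x+j∈C (A₁⊆H₁ (subst (_ ∈ˢ_) D≡A₁ x+j∈D)))
             x+j∈D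

    -- Translations by `J` come from `H₁`, so they preserve every chosen coset; `A₁` is preserved by
    -- assumption.
    ⋃𝒜-closed : ∀ {J} → J ⊆ H₁ → ClosedUnder J A₁ → ClosedUnder J (⋃ 𝒜)
    ⋃𝒜-closed J⊆H₁ A₁-closed x∈ j∈J with ∈-⋃⁻ 𝒜 x∈
    ... | B , B∈𝒜 , x∈B with ∈-𝒜⁻ B∈𝒜
    ... | inj₁ refl = ∈-⋃⁺ B∈𝒜 (A₁-closed x∈B j∈J)
    ... | inj₂ (C , C∈𝒞 , B∈𝒫) =
      let D , D∈𝒫 , x+j∈D = part-of C∈𝒞
            (coset-closed H₁≤G (proj₁ (𝒞-cosets C∈𝒞)) (part⊆ C∈𝒞 B∈𝒫 x∈B) (J⊆H₁ j∈J))
      in ∈-⋃⁺ (∈-𝒜⁺ C∈𝒞 D∈𝒫) x+j∈D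

    -- Adding `j` to a point of `B` stays inside `C`, and two points of `C` differ by an element of
    -- `H₁`. Arguing through `B` also covers an empty `A₁`, which is a union of cosets of every
    -- subgroup.
    stabilizer⊆H₁ : ∀ {C B J} → C ∈ 𝒞 → B ∈ 𝒫 C → ClosedUnder J B → J ⊆ H₁
    stabilizer⊆H₁ {B = B} C∈𝒞 B∈𝒫 B-closed = ∈ᴳ⇒⊆ λ {j} j∈J →
      let i , i∈B = IsPartition.nonempty (𝒫-partition C∈𝒞) B∈𝒫
          b∈B = ∈ˢ⇒∈ᴳ B i∈B
      in ∈ᴳ-resp-≈ {A = H₁} (xyx⁻¹≈y (from i) j)
           (coset-diff H₁≤G (proj₁ (𝒞-cosets C∈𝒞))
             (part⊆ C∈𝒞 B∈𝒫 (B-closed b∈B j∈J)) (part⊆ C∈𝒞 B∈𝒫 b∈B))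

    𝒜-isBimodal : IsBimodal 𝒜
    𝒜-isBimodal A∈𝒜 δ _ with ∈-𝒜⁻ A∈𝒜
    ... | inj₁ refl =
      -- For `A₁` the subgroup is `H₁`, viewed as a coset of itself that contains all of `A₁`.
      N-dichotomy 𝒜 δ
        (λ x∈ y∈ → coset-diff H₁≤G subgroup-isCoset (A₁⊆H₁ x∈) (A₁⊆H₁ y∈))
        A₁-others-closed
    ... | inj₂ (C , C∈𝒞 , B∈𝒫) =
      -- For a part, one `J` preserves `B`, `A₁` and, since it lies in `H₁`, every chosen coset.
      let J , J≤G , A₁-union , B-coset = 𝒫-cosets C∈𝒞 B∈𝒫
          B-closed = coset-closed J≤G B-coset
      in N-dichotomy 𝒜 δ (coset-diff J≤G B-coset)
           (others-closed J≤G 𝒜-pairwiseDisjoint A∈𝒜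
             (⋃𝒜-closed (stabilizer⊆H₁ C∈𝒞 B∈𝒫 B-closed) (unionOfCosets-closed J≤G A₁-union))
             B-closed)

    small-member≡A₁ : ∀ {B} → B ∈ 𝒜 → ∣ B ∣ < ∣ internalDifferenceGroup B ∣ → B ≡ A₁
    small-member≡A₁ B∈𝒜 small with ∈-𝒜⁻ B∈𝒜
    ... | inj₁ B≡A₁ = B≡A₁
    ... | inj₂ (C , C∈𝒞 , B∈𝒫) =
      let J , J≤G , _ , B-coset = 𝒫-cosets C∈𝒞 B∈𝒫
      in ⊥-elim (≤⇒≯ (∣internalDifferenceGroup∣≤∣coset∣ J≤G B-coset) small)

theorem3p17 : ∀ {c ℓ} (G : FiniteAbelianGroup c ℓ) → let open Subsets G in
    (H₁ A₁ : Subset order) →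
    IsSubgroup H₁ → A₁ ⊂ H₁ → internalDifferenceGroup A₁ ≡ H₁ →
    (𝒞 : List (Subset order)) →
    (∀ {C} → C ∈ 𝒞 → IsCoset H₁ C × C ≢ H₁) →
    (𝒫 : Subset order → List (Subset order)) →
    (∀ {C} → C ∈ 𝒞 → IsPartition (𝒫 C) C) →
    (∀ {C B} → C ∈ 𝒞 → B ∈ 𝒫 C →
    ∃ λ J → IsSubgroup J × IsUnionOfCosets J A₁ × IsCoset J B) →
    let 𝒜 = A₁ ∷ concatMap 𝒫 𝒞 in
    PairwiseDisjoint 𝒜 ×
    IsBimodal 𝒜 ×
    ∣ A₁ ∣ < ∣ internalDifferenceGroup A₁ ∣ ×
    (∀ {B} → B ∈ 𝒜 → ∣ B ∣ < ∣ internalDifferenceGroup B ∣ → B ≡ A₁)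
theorem3p17 G H₁ A₁ H₁≤G A₁⊂H₁ ⟨A₁⟩≡H₁ 𝒞 𝒞-cosets 𝒫 𝒫-partition 𝒫-cosets =
    𝒜-pairwiseDisjoint
  , 𝒜-isBimodal
  -- The internal difference group of `A₁` is all of `H₁`, which contains `A₁` strictly.
  , subst (λ H → ∣ A₁ ∣ < ∣ H ∣) (sym ⟨A₁⟩≡H₁) (p⊂q⇒∣p∣<∣q∣ A₁⊂H₁)
  , small-member≡A₁
  where
  open FiniteAbelianGroupProperties G
  open PartitionedCosets H₁≤G (proj₁ A₁⊂H₁) 𝒞-cosets 𝒫-partition 𝒫-cosets
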